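{- For $n\ge 1$ let $s_n$ be the number of Schroeder trees with $n$ leaves, and let $S(x)=\sum_{n\ge 1}s_nx^n$ be the ordinary generating function. Then $$S(x)=\frac{2x}{1+x+\sqrt{1-6x+x^2}}.$$
   Context: A Schroeder tree is a finite rooted plane tree (the children of each vertex are linearly ordered) in which every non-leaf vertex has at least two children. A leaf is a vertex with no children; the one-vertex tree is a Schroeder tree with one leaf. Trees are counted up to isomorphism of rooted plane trees. $\sqrt{1-6x+x^2}$ denotes the formal power series square root with constant term $1$. -}

module Defs where

open import Data.Fin.Base using (Fin; zero; suc; toℕ; inject₁; fromℕ)
open import Data.Fin.Properties using (toℕ<n; toℕ-inject₁; toℕ-fromℕ)
open import Data.Integer.Base using (+_)
open import Data.List.Base
  using (List; []; _∷_; length; lookup; map; filter; deduplicate; cartesianProductWith)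
open import Data.List.Membership.Propositional using (_∈_)
open import Data.List.Membership.Propositional.Properties
  using (∈-lookup; ∈-map⁺; ∈-filter⁺; ∈-filter⁻; ∈-deduplicate⁺; ∈-deduplicate⁻;
         ∈-cartesianProductWith⁺)
open import Data.List.Properties using (∷-injective)
open import Data.List.Relation.Unary.All as All using (All; []; _∷_)
open import Data.List.Relation.Unary.AllPairs using ([]; _∷_)
open import Data.List.Relation.Unary.Any using (here; there; index)
open import Data.List.Relation.Unary.Any.Properties using (lookup-index)
open import Data.List.Relation.Unary.Unique.Propositional using (Unique)
open import Data.List.Relation.Unary.Unique.DecPropositional.Properties using (deduplicate-!)
open import Data.Nat.Base as ℕ using (ℕ; zero; suc; _∸_; _≤_; _<_; z≤n; s≤s; s≤s⁻¹)
import Data.Nat.Properties as ℕₚ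
open import Data.Product using (∃; _×_; _,_; proj₁; proj₂)
open import Data.Rational.Base as ℚ using (ℚ; 0ℚ; 1ℚ; ½)
import Data.Rational.Properties as ℚₚ
open import Data.Rational.Solver using (module +-*-Solver)
open import Function.Bundles using (_↔_; mk↔ₛ′)
open import Relation.Binary.Definitions using (DecidableEquality)
open import Relation.Binary.PropositionalEquality
open import Relation.Nullary using (Dec; yes; no; contradiction)
open import Relation.Nullary.Decidable using (map′; _×-dec_)
open import Relation.Unary using (Pred; Decidable; Irrelevant)

open import Algebra.Properties.Monoid.Sum ℚₚ.+-0-monoid
  using (sum-syntax; sum-cong-≗; sum-init-last)

-- The children of a vertex are listed in order, so isomorphism of rooted
-- plane trees is propositional equality.
data PlaneTree : Set where
  node : List PlaneTree → PlaneTree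

data IsSchroeder : PlaneTree → Set where
  leaf   : IsSchroeder (node [])
  branch : ∀ {ts} → 2 ≤ length ts → All IsSchroeder ts → IsSchroeder (node ts)

leaves  : PlaneTree → ℕ
leaves* : List PlaneTree → ℕ
leaves (node [])       = 1
leaves (node (t ∷ ts)) = leaves t ℕ.+ leaves* ts
leaves* []       = 0
leaves* (t ∷ ts) = leaves t ℕ.+ leaves* ts

-- `IsSchroeder` and `_≡_` on ℕ are proof-irrelevant, so the
-- elements of this type are in bijection with the trees themselves.
SchroederTree : ℕ → Set
SchroederTree n = ∃ λ t → IsSchroeder t × leaves t ≡ n

Finite : Set → Set
Finite A = ∃ λ k → A ↔ Fin k

private

  lookup-injective : ∀ {A : Set} {xs : List A} → Unique xs →
                     ∀ i j → lookup xs i ≡ lookup xs j → i ≡ j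
  lookup-injective (_ ∷ _)    zero    zero    _  = refl
  lookup-injective (x∉ ∷ _)   zero    (suc j) eq = contradiction eq (All.lookup x∉ (∈-lookup j))
  lookup-injective (x∉ ∷ _)   (suc i) zero    eq = contradiction (sym eq) (All.lookup x∉ (∈-lookup i))
  lookup-injective (_ ∷ xs!)  (suc i) (suc j) eq = cong suc (lookup-injective xs! i j eq)

  finite : ∀ {A : Set} {P : Pred A _} → DecidableEquality A → Decidable P → Irrelevant P →
           (xs : List A) → (∀ {x} → P x → x ∈ xs) → Finite (∃ P)
  finite {A} {P} _≟_ P? P-irr xs complete = length ys , mk↔ₛ′ to from to∘from from∘to
    where
    ys : List A
    ys = deduplicate _≟_ (filter P? xs)

    ∈ys : ∀ {x} → P x → x ∈ ys
    ∈ys p = ∈-deduplicate⁺ _≟_ (∈-filter⁺ P? (complete p) p)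

    ys⇒P : ∀ {x} → x ∈ ys → P x
    ys⇒P x∈ = proj₂ (∈-filter⁻ P? {xs = xs} (∈-deduplicate⁻ _≟_ (filter P? xs) x∈))

    to : ∃ P → Fin (length ys)
    to (x , p) = index (∈ys p)

    from : Fin (length ys) → ∃ P
    from i = lookup ys i , ys⇒P (∈-lookup i)

    to∘from : ∀ i → to (from i) ≡ i
    to∘from i = lookup-injective (deduplicate-! _≟_ (filter P? xs)) (to (from i)) i
                  (sym (lookup-index (∈ys (ys⇒P (∈-lookup i)))))

    ext : ∀ {x y} {p : P x} {q : P y} → x ≡ y → (x , p) ≡ (y , q)
    ext refl = cong (_ ,_) (P-irr _ _)

    from∘to : ∀ xp → from (to xp) ≡ xp
    from∘to (x , p) = ext (sym (lookup-index (∈ys p)))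

node-injective : ∀ {ts us} → node ts ≡ node us → ts ≡ us
node-injective refl = refl

infix 4 _≟ᵗ_ _≟*_
_≟ᵗ_ : DecidableEquality PlaneTree
_≟*_ : DecidableEquality (List PlaneTree)
node ts ≟ᵗ node us = map′ (cong node) node-injective (ts ≟* us)
[]       ≟* []       = yes refl
[]       ≟* (_ ∷ _)  = no λ ()
(_ ∷ _)  ≟* []       = no λ ()
(t ∷ ts) ≟* (u ∷ us) =
  map′ (λ (p , q) → cong₂ _∷_ p q) ∷-injective (t ≟ᵗ u ×-dec ts ≟* us)

isSchroeder?  : Decidable IsSchroeder
isSchroeder?* : Decidable (All IsSchroeder)
isSchroeder? (node [])       = yes leaf
isSchroeder? (node (t ∷ ts)) =
  map′ (λ (p , q) → branch p q) (λ { (branch p q) → p , q })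
       (2 ℕₚ.≤? length (t ∷ ts) ×-dec isSchroeder?* (t ∷ ts))
isSchroeder?* []       = yes []
isSchroeder?* (t ∷ ts) =
  map′ (λ (p , q) → p ∷ q) (λ { (p ∷ q) → p , q }) (isSchroeder? t ×-dec isSchroeder?* ts)

isSchroeder-irrelevant  : Irrelevant IsSchroeder
isSchroeder-irrelevant* : Irrelevant (All IsSchroeder)
isSchroeder-irrelevant leaf          leaf          = refl
isSchroeder-irrelevant (branch p ps) (branch q qs) =
  cong₂ branch (ℕₚ.≤-irrelevant p q) (isSchroeder-irrelevant* ps qs)
isSchroeder-irrelevant* []       []       = refl
isSchroeder-irrelevant* (p ∷ ps) (q ∷ qs) =
  cong₂ _∷_ (isSchroeder-irrelevant p q) (isSchroeder-irrelevant* ps qs)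

leaves>0 : ∀ t → 1 ≤ leaves t
leaves>0 (node [])       = s≤s z≤n
leaves>0 (node (t ∷ ts)) = ℕₚ.≤-trans (leaves>0 t) (ℕₚ.m≤m+n _ _)

length≤leaves* : ∀ ts → length ts ≤ leaves* ts
length≤leaves* []       = z≤n
length≤leaves* (t ∷ ts) = ℕₚ.+-mono-≤ (leaves>0 t) (length≤leaves* ts)

private

  lists : {A : Set} → ℕ → List A → List (List A)
  lists zero    xs = [] ∷ []
  lists (suc w) xs = [] ∷ cartesianProductWith _∷_ xs (lists w xs)

  ∈-lists : ∀ {A : Set} {xs ys : List A} w → All (_∈ xs) ys → length ys ≤ w → ys ∈ lists w xs
  ∈-lists zero    []       _       = here refl
  ∈-lists (suc w) []       _       = here refl
  ∈-lists (suc w) (p ∷ ps) (s≤s l) = there (∈-cartesianProductWith⁺ _∷_ p (∈-lists w ps l))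

  -- All plane trees of height less than d in which every vertex has at
  -- most w children.
  trees : ℕ → ℕ → List PlaneTree
  trees zero    w = []
  trees (suc d) w = map node (lists w (trees d w))

  ∈-trees  : ∀ {t} d w → IsSchroeder t → leaves t ≤ d → leaves t ≤ w → t ∈ trees d w
  ∈-trees* : ∀ {ts} d w → All IsSchroeder ts → leaves* ts ≤ d → leaves* ts ≤ w →
             All (_∈ trees d w) ts
  ∈-trees {t} zero w _ ≤d ≤w = contradiction (ℕₚ.≤-trans (leaves>0 t) ≤d) λ ()
  ∈-trees (suc d) w leaf  ≤d ≤w = ∈-map⁺ node (∈-lists w [] z≤n)
  ∈-trees (suc d) w (branch (s≤s ()) (_ ∷ [])) ≤d ≤w
  ∈-trees (suc d) w (branch {t ∷ u ∷ us} _ (p ∷ ps)) ≤d ≤w =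
    ∈-map⁺ node (∈-lists w
      (∈-trees d w p
         (s≤s⁻¹ (ℕₚ.≤-trans (ℕₚ.m<m+n _ 0<rest) ≤d))
         (ℕₚ.≤-trans (ℕₚ.m≤m+n _ _) ≤w)
       ∷ ∈-trees* d w ps
         (s≤s⁻¹ (ℕₚ.≤-trans (ℕₚ.m<n+m _ (leaves>0 t)) ≤d))
         (ℕₚ.≤-trans (ℕₚ.m≤n+m _ (leaves t)) ≤w))
      (ℕₚ.≤-trans (length≤leaves* (t ∷ u ∷ us)) ≤w))
    where
    0<rest : 0 < leaves* (u ∷ us)
    0<rest = ℕₚ.≤-trans (leaves>0 u) (ℕₚ.m≤m+n _ _)
  ∈-trees* d w []       ≤d ≤w = []
  ∈-trees* {t ∷ _} d w (p ∷ ps) ≤d ≤w =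
    ∈-trees d w p (ℕₚ.m+n≤o⇒m≤o _ ≤d) (ℕₚ.m+n≤o⇒m≤o _ ≤w)
    ∷ ∈-trees* d w ps (ℕₚ.m+n≤o⇒n≤o (leaves t) ≤d) (ℕₚ.m+n≤o⇒n≤o (leaves t) ≤w)

schroederTree-finite : ∀ n → Finite (SchroederTree n)
schroederTree-finite n = finite _≟ᵗ_
  (λ t → isSchroeder? t ×-dec leaves t ℕₚ.≟ n)
  (λ (p , e) (q , f) → cong₂ _,_ (isSchroeder-irrelevant p q) (ℕₚ.≡-irrelevant e f))
  (trees n n)
  (λ (p , e) → ∈-trees n n p (ℕₚ.≤-reflexive e) (ℕₚ.≤-reflexive e))

s : ℕ → ℕ
s n = proj₁ (schroederTree-finite n)

s-counts : ∀ n → SchroederTree n ↔ Fin (s n)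
s-counts n = proj₂ (schroederTree-finite n)

PowerSeries : Set
PowerSeries = ℕ → ℚ

infix  4 _≈_
infixl 6 _+_ _-_
infixl 7 _*_ _/_
infix  8 _⁻¹ √_

_≈_ : PowerSeries → PowerSeries → Set
f ≈ g = ∀ n → f n ≡ g n

ℕ→ℚ : ℕ → ℚ
ℕ→ℚ k = + k ℚ./ 1

# : ℕ → PowerSeries
# k zero    = ℕ→ℚ k
# k (suc _) = 0ℚ

X : PowerSeries
X 1 = 1ℚ
X _ = 0ℚ

_+_ _-_ _*_ : PowerSeries → PowerSeries → PowerSeries
(f + g) n = f n ℚ.+ g n
(f - g) n = f n ℚ.- g n
(f * g) n = ∑[ i < suc n ] (f (toℕ i) ℚ.* g (n ∸ toℕ i))

-- The n-th coefficient of Φ f depends only on the coefficients of f below n,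
-- so f ≈ Φ f has exactly one solution, `fix Φ`.

Causal : (PowerSeries → PowerSeries) → Set
Causal Φ = ∀ {f g} n → (∀ {k} → k < n → f k ≡ g k) → Φ f n ≡ Φ g n

iterate : (PowerSeries → PowerSeries) → ℕ → PowerSeries
iterate Φ zero    = # 0
iterate Φ (suc m) = Φ (iterate Φ m)

fix : (PowerSeries → PowerSeries) → PowerSeries
fix Φ n = iterate Φ (suc n) n

fix-unique : ∀ {Φ} → Causal Φ → ∀ {f} → f ≈ Φ f → f ≈ fix Φ
fix-unique {Φ} causal {f} f≈Φf n = agree (suc n) ℕₚ.≤-refl
  where
  agree : ∀ m {k} → k < m → f k ≡ iterate Φ m k
  agree (suc m) {k} k<1+m = trans (f≈Φf k)
    (causal k λ j<k → agree m (ℕₚ.<-≤-trans j<k (s≤s⁻¹ k<1+m)))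

fix-fixed : ∀ {Φ} → Causal Φ → fix Φ ≈ Φ (fix Φ)
fix-fixed {Φ} causal n = causal n λ k<n → stable k<n ℕₚ.≤-refl
  where
  stable : ∀ {l m k} → k < l → k < m → iterate Φ l k ≡ iterate Φ m k
  stable {suc l} {suc m} {k} k<l k<m = causal k λ j<k →
    stable (ℕₚ.<-≤-trans j<k (s≤s⁻¹ k<l)) (ℕₚ.<-≤-trans j<k (s≤s⁻¹ k<m))

-- The inverse g of f satisfies f₀ g₀ = 1 and f₀ gₙ₊₁ + Σ_{i ≤ n} fᵢ₊₁ gₙ₋ᵢ = 0.

reciprocalStep : (f : PowerSeries) → .{{ℚ.NonZero (f 0)}} → PowerSeries → PowerSeries
reciprocalStep f g zero    = ℚ.1/ f 0
reciprocalStep f g (suc n) =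
  ℚ.- (ℚ.1/ f 0 ℚ.* (∑[ i < suc n ] (f (suc (toℕ i)) ℚ.* g (n ∸ toℕ i))))

_⁻¹ : (f : PowerSeries) → .{{ℚ.NonZero (f 0)}} → PowerSeries
f ⁻¹ = fix (reciprocalStep f)

_/_ : (f g : PowerSeries) → .{{ℚ.NonZero (g 0)}} → PowerSeries
f / g = f * g ⁻¹

⁻¹-inverse : ∀ f .{{_ : ℚ.NonZero (f 0)}} → f * f ⁻¹ ≈ # 1
⁻¹-inverse f zero    = trans (ℚₚ.+-identityʳ _) (ℚₚ.*-inverseʳ (f 0))
⁻¹-inverse f (suc n) = begin
  f 0 ℚ.* g (suc n) ℚ.+ Σ                    ≡⟨ cong (λ x → f 0 ℚ.* x ℚ.+ Σ) (fix-fixed causal (suc n)) ⟩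
  f 0 ℚ.* ℚ.- (ℚ.1/ f 0 ℚ.* Σ) ℚ.+ Σ         ≡⟨ solve 3 (λ a b c → a :* (:- (b :* c)) :+ c := c :- (a :* b) :* c) refl (f 0) (ℚ.1/ f 0) Σ ⟩
  Σ ℚ.- (f 0 ℚ.* ℚ.1/ f 0) ℚ.* Σ             ≡⟨ cong (λ x → Σ ℚ.- x ℚ.* Σ) (ℚₚ.*-inverseʳ (f 0)) ⟩
  Σ ℚ.- 1ℚ ℚ.* Σ                             ≡⟨ solve 1 (λ c → c :- con 1ℚ :* c := con 0ℚ) refl Σ ⟩
  0ℚ                                         ∎
  where
  open ≡-Reasoning
  open +-*-Solver
  g : PowerSeries
  g = f ⁻¹
  Σ : ℚ
  Σ = ∑[ i < suc n ] (f (suc (toℕ i)) ℚ.* g (n ∸ toℕ i))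
  causal : Causal (reciprocalStep f)
  causal zero    _  = refl
  causal (suc n) eq = cong (λ x → ℚ.- (ℚ.1/ f 0 ℚ.* x)) (sum-cong-≗ {suc n} λ i →
    cong (f (suc (toℕ i)) ℚ.*_) (eq (s≤s (ℕₚ.m∸n≤m n (toℕ i)))))

-- A series r with r₀ = 1 and r² = f satisfies
-- 2 rₙ₊₁ + Σ_{i < n} rᵢ₊₁ rₙ₋ᵢ = fₙ₊₁.

sqrtStep : PowerSeries → PowerSeries → PowerSeries
sqrtStep f r zero    = 1ℚ
sqrtStep f r (suc n) =
  ½ ℚ.* (f (suc n) ℚ.- ∑[ i < n ] (r (suc (toℕ i)) ℚ.* r (n ∸ toℕ i)))

-- Meaningful only when f has constant term 1; see `√-square`, `√-unique`.
√_ : PowerSeries → PowerSeries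
√ f = fix (sqrtStep f)

private

  sqrtStep-causal : ∀ f → Causal (sqrtStep f)
  sqrtStep-causal f zero    _  = refl
  sqrtStep-causal f (suc n) eq = cong (λ x → ½ ℚ.* (f (suc n) ℚ.- x)) (sum-cong-≗ {n} λ i →
    cong₂ ℚ._*_ (eq (s≤s (toℕ<n i))) (eq (s≤s (ℕₚ.m∸n≤m n (toℕ i)))))

  square-suc : ∀ r → r 0 ≡ 1ℚ → ∀ n → (r * r) (suc n) ≡
    r (suc n) ℚ.+ (∑[ i < n ] (r (suc (toℕ i)) ℚ.* r (n ∸ toℕ i)) ℚ.+ r (suc n))
  square-suc r r₀≡1 n = cong₂ ℚ._+_
    (trans (cong (ℚ._* r (suc n)) r₀≡1) (ℚₚ.*-identityˡ (r (suc n))))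
    (trans (sum-init-last {n} term) (cong₂ ℚ._+_
      (sum-cong-≗ {n} λ i → cong (λ k → r (suc k) ℚ.* r (n ∸ k)) (toℕ-inject₁ i))
      (trans (cong (λ k → r (suc k) ℚ.* r (n ∸ k)) (toℕ-fromℕ n))
        (trans (cong (r (suc n) ℚ.*_) (trans (cong r (ℕₚ.n∸n≡0 n)) r₀≡1)) (ℚₚ.*-identityʳ (r (suc n)))))))
    where
    term : Fin (suc n) → ℚ
    term i = r (suc (toℕ i)) ℚ.* r (n ∸ toℕ i)

√-constant : ∀ f → (√ f) 0 ≡ 1ℚ
√-constant f = refl

√-square : ∀ f → f 0 ≡ 1ℚ → √ f * √ f ≈ f
√-square f f₀≡1 zero    = sym f₀≡1
√-square f f₀≡1 (suc n) = begin
  (r * r) (suc n)                    ≡⟨ square-suc r refl n ⟩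
  r (suc n) ℚ.+ (Σ ℚ.+ r (suc n))    ≡⟨ cong (λ x → x ℚ.+ (Σ ℚ.+ x)) (fix-fixed (sqrtStep-causal f) (suc n)) ⟩
  h ℚ.+ (Σ ℚ.+ h)                    ≡⟨ solve 2 (λ a c → con ½ :* (a :- c) :+ (c :+ con ½ :* (a :- c)) := a) refl (f (suc n)) Σ ⟩
  f (suc n)                          ∎
  where
  open ≡-Reasoning
  open +-*-Solver
  r : PowerSeries
  r = √ f
  Σ h : ℚ
  Σ = ∑[ i < n ] (r (suc (toℕ i)) ℚ.* r (n ∸ toℕ i))
  h = ½ ℚ.* (f (suc n) ℚ.- Σ)

√-unique : ∀ f r → r 0 ≡ 1ℚ → r * r ≈ f → r ≈ √ f
√-unique f r r₀≡1 r²≈f = fix-unique (sqrtStep-causal f) λ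
  { zero    → r₀≡1
  ; (suc n) → let Σ = ∑[ i < n ] (r (suc (toℕ i)) ℚ.* r (n ∸ toℕ i)) in
      trans
        (solve 2 (λ a c → a := con ½ :* ((a :+ (c :+ a)) :- c)) refl (r (suc n)) Σ)
        (cong (λ x → ½ ℚ.* (x ℚ.- Σ)) (trans (sym (square-suc r r₀≡1 n)) (r²≈f (suc n))))
  }
  where open +-*-Solver

S : PowerSeries
S zero    = 0ℚ
S (suc n) = ℕ→ℚ (s (suc n))

{-# OPTIONS --safe #-}
module Submission where

-- Removing the first child of a non-leaf Schroeder tree leaves a list of at
-- least one tree, which is either a single tree or the children of another
-- non-leaf tree. Hence S - x = S (S + (S - x)), that is x + 2S² = S + xS. So
-- (1 + x - 4S)² = 1 - 6x + x², which makes 1 + x - 4S the square root with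
-- constant term 1, and S (1 + x + (1 + x - 4S)) = 2x.

open import Algebra.Bundles using (CommutativeRing)
import Algebra.Construct.Pointwise as Pointwise
open import Algebra.Solver.Ring.AlmostCommutativeRing
  using (fromCommutativeRing; _-Raw-AlmostCommutative⟶_)
open import Data.Empty using (⊥; ⊥-elim)
open import Data.Fin.Base using (Fin; zero; suc; toℕ; fromℕ<)
open import Data.Fin.Permutation using (↔⇒≡)
open import Data.Fin.Properties using (toℕ≤pred[n]; toℕ-fromℕ<; toℕ-injective; 0↔⊥; 1↔⊤; +↔⊎; *↔×)
open import Data.Integer.Base as ℤ using (ℤ; +_; -[1+_]; +[1+_])
import Data.Integer.Properties as ℤₚ
open import Data.List.Base using ([]; _∷_)
open import Data.List.Relation.Unary.All using ([]; _∷_)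
open import Data.Maybe.Base using (map)
open import Data.Nat.Base as ℕ using (ℕ; zero; suc; _∸_; z≤n; s≤s; nonZero)
import Data.Nat.Properties as ℕₚ
open import Data.Product.Base using (∃; _×_; _,_; proj₁)
open import Data.Product.Function.NonDependent.Propositional using (_×-↔_)
open import Data.Rational.Base as ℚ using (ℚ; 0ℚ; 1ℚ)
import Data.Rational.Properties as ℚₚ
open import Algebra.Properties.Group ℚₚ.+-0-group using (⁻¹-involutive)
open import Algebra.Properties.Monoid.Sum ℚₚ.+-0-monoid using (sum-syntax)
open import Data.Rational.Solver using (module +-*-Solver)
open import Data.Rational.Unnormalised.Base as ℚᵘ using (mkℚᵘ)
import Data.Rational.Unnormalised.Properties as ℚᵘₚ
open import Data.Sum.Base using (_⊎_; inj₁; inj₂; [_,_]; [_,_]′)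
open import Data.Sum.Function.Propositional using (_⊎-↔_)
open import Data.Unit.Base using (⊤; tt)
open import Defs
open import Function.Base using (_∘_; const)
open import Function.Bundles using (_↔_; mk↔ₛ′; module Inverse)
open import Function.Properties.Inverse using (↔-sym; ↔-trans)
open import Relation.Binary.PropositionalEquality hiding (setoid; [_])
open import Relation.Nullary.Decidable using (dec⇒maybe)

-- The ring of formal power series

tail : PowerSeries → PowerSeries
tail f = f ∘ suc

scale : ℚ → PowerSeries → PowerSeries
scale q f n = q ℚ.* f n

-- Extends `#` to rational arguments, so that the homomorphism laws of `fromℤ` reduce to those of
-- `ℤ→ℚ`.
constant : ℚ → PowerSeries
constant q zero    = q
constant q (suc _) = 0ℚ

-- Everything about `_*_` follows from the recursion
-- (f * g) (suc n) = f 0 ℚ.* g (suc n) ℚ.+ (tail f * g) n, which holds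
-- definitionally, and from its mirror image *-tailʳ.

*-cong : ∀ {f f′ g g′} → f ≈ f′ → g ≈ g′ → f * g ≈ f′ * g′
*-cong f≈ g≈ zero    = cong₂ (λ x y → x ℚ.* y ℚ.+ 0ℚ) (f≈ 0) (g≈ 0)
*-cong f≈ g≈ (suc n) = cong₂ ℚ._+_
  (cong₂ ℚ._*_ (f≈ 0) (g≈ (suc n))) (*-cong (f≈ ∘ suc) g≈ n)

*-zeroˡ : ∀ f → const 0ℚ * f ≈ const 0ℚ
*-zeroˡ f zero    = cong (ℚ._+ 0ℚ) (ℚₚ.*-zeroˡ (f 0))
*-zeroˡ f (suc n) = cong₂ ℚ._+_ (ℚₚ.*-zeroˡ (f (suc n))) (*-zeroˡ f n)

constant-* : ∀ q f → constant q * f ≈ scale q f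
constant-* q f zero    = ℚₚ.+-identityʳ _
constant-* q f (suc n) =
  trans (cong (q ℚ.* f (suc n) ℚ.+_) (*-zeroˡ f n)) (ℚₚ.+-identityʳ _)

scale-* : ∀ q f g → scale q f * g ≈ scale q (f * g)
scale-* q f g zero    = solve 3 (λ q a b → q :* a :* b :+ con 0ℚ := q :* (a :* b :+ con 0ℚ)) refl
  q (f 0) (g 0)
  where open +-*-Solver
scale-* q f g (suc n) =
  trans (cong (q ℚ.* f 0 ℚ.* g (suc n) ℚ.+_) (scale-* q (tail f) g n))
        (solve 4 (λ q a b c → q :* a :* b :+ q :* c := q :* (a :* b :+ c)) refl
          q (f 0) (g (suc n)) ((tail f * g) n))
  where open +-*-Solver

*-distribʳ-+ : ∀ h f g → (f + g) * h ≈ f * h + g * h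
*-distribʳ-+ h f g zero    =
  solve 3 (λ a b c → (a :+ b) :* c :+ con 0ℚ := a :* c :+ con 0ℚ :+ (b :* c :+ con 0ℚ)) refl
    (f 0) (g 0) (h 0)
  where open +-*-Solver
*-distribʳ-+ h f g (suc n) =
  trans (cong ((f 0 ℚ.+ g 0) ℚ.* h (suc n) ℚ.+_) (*-distribʳ-+ h (tail f) (tail g) n))
        (solve 5 (λ a b c u v → (a :+ b) :* c :+ (u :+ v) := a :* c :+ u :+ (b :* c :+ v)) refl
          (f 0) (g 0) (h (suc n)) ((tail f * h) n) ((tail g * h) n))
  where open +-*-Solver

-- By induction: the term with `f 0` splits off on the left by definition, the term with `g 0` on
-- the right by hypothesis, and `tail f * tail g` remains between them.
*-tailʳ : ∀ f g n → (f * g) (suc n) ≡ f (suc n) ℚ.* g 0 ℚ.+ (f * tail g) n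
*-tailʳ f g zero    = solve 4 (λ a b c d → a :* d :+ (b :* c :+ con 0ℚ) := b :* c :+ (a :* d :+ con 0ℚ)) refl
  (f 0) (f 1) (g 0) (g 1)
  where open +-*-Solver
*-tailʳ f g (suc n) =
  trans (cong (f 0 ℚ.* g (suc (suc n)) ℚ.+_) (*-tailʳ (tail f) g n))
        (solve 3 (λ x y z → x :+ (y :+ z) := y :+ (x :+ z)) refl
          (f 0 ℚ.* g (suc (suc n))) (f (suc (suc n)) ℚ.* g 0) ((tail f * tail g) n))
  where open +-*-Solver

*-comm : ∀ f g → f * g ≈ g * f
*-comm f g zero    = cong (ℚ._+ 0ℚ) (ℚₚ.*-comm (f 0) (g 0))
*-comm f g (suc n) = trans
  (cong₂ ℚ._+_ (ℚₚ.*-comm (f 0) (g (suc n))) (*-comm (tail f) g n))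
  (sym (*-tailʳ g f n))

*-assoc : ∀ f g h → (f * g) * h ≈ f * (g * h)
*-assoc f g h zero    =
  solve 3 (λ a b c → (a :* b :+ con 0ℚ) :* c :+ con 0ℚ := a :* (b :* c :+ con 0ℚ) :+ con 0ℚ) refl
    (f 0) (g 0) (h 0)
  where open +-*-Solver
*-assoc f g h (suc n) = begin
  -- The tail of `f * g` is `scale (f 0) (tail g) + tail f * g` by definition.
  (f * g) 0 ℚ.* h (suc n) ℚ.+ ((scale (f 0) (tail g) + tail f * g) * h) n
    ≡⟨ cong (c ℚ.+_) (*-distribʳ-+ h (scale (f 0) (tail g)) (tail f * g) n) ⟩
  c ℚ.+ ((scale (f 0) (tail g) * h) n ℚ.+ ((tail f * g) * h) n)
    ≡⟨ cong (c ℚ.+_) (cong₂ ℚ._+_ (scale-* (f 0) (tail g) h n) (*-assoc (tail f) g h n)) ⟩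
  c ℚ.+ (f 0 ℚ.* (tail g * h) n ℚ.+ (tail f * (g * h)) n)
    ≡⟨ solve 5 (λ a b c u v → (a :* b :+ con 0ℚ) :* c :+ (a :* u :+ v) := a :* (b :* c :+ u) :+ v) refl
         (f 0) (g 0) (h (suc n)) ((tail g * h) n) ((tail f * (g * h)) n) ⟩
  f 0 ℚ.* (g * h) (suc n) ℚ.+ (tail f * (g * h)) n ∎
  where
  open ≡-Reasoning
  open +-*-Solver
  c : ℚ
  c = (f * g) 0 ℚ.* h (suc n)

#1≈constant : # 1 ≈ constant 1ℚ
#1≈constant zero    = refl
#1≈constant (suc _) = refl

*-identityˡ : ∀ f → # 1 * f ≈ f
*-identityˡ f n =
  trans (*-cong {g = f} #1≈constant (λ _ → refl) n)
        (trans (constant-* 1ℚ f n) (ℚₚ.*-identityˡ (f n)))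

powerSeriesRing : CommutativeRing _ _
powerSeriesRing = record
  { Carrier = PowerSeries
  ; _≈_     = _≈_
  ; _+_     = _+_
  ; _*_     = _*_
  ; -_      = λ f n → ℚ.- f n
  ; 0#      = const 0ℚ
  ; 1#      = # 1
  ; isCommutativeRing = record
    { isRing = record
      { +-isAbelianGroup = Pointwise.isAbelianGroup ℕ ℚₚ.+-0-isAbelianGroup
      ; *-cong           = *-cong
      ; *-assoc          = *-assoc
      ; *-identity       = *-identityˡ , λ f n → trans (*-comm f (# 1) n) (*-identityˡ f n)
      ; distrib          =
          (λ f g h n → trans (*-comm f (g + h) n)
             (trans (*-distribʳ-+ f g h n) (cong₂ ℚ._+_ (*-comm g f n) (*-comm h f n))))
        , *-distribʳ-+
      }
    ; *-comm = *-comm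
    }
  }

-- Integer constants, the ring solver and polynomial identities

ℤ→ℚ : ℤ → ℚ
ℤ→ℚ z = z ℚ./ 1

-- `toℚᵘ` is injective, respects addition up to `≃` and undoes `fromℚᵘ` up to `≃`, so the claim can
-- be checked on unnormalised fractions.
fromℚᵘ-homo-+ : ∀ p q → ℚ.fromℚᵘ (p ℚᵘ.+ q) ≡ ℚ.fromℚᵘ p ℚ.+ ℚ.fromℚᵘ q
fromℚᵘ-homo-+ p q = ℚₚ.toℚᵘ-injective (begin
  ℚ.toℚᵘ (ℚ.fromℚᵘ (p ℚᵘ.+ q))                       ≈⟨ ℚₚ.toℚᵘ-fromℚᵘ (p ℚᵘ.+ q) ⟩
  p ℚᵘ.+ q                                           ≈⟨ ℚᵘₚ.+-cong (ℚₚ.toℚᵘ-fromℚᵘ p) (ℚₚ.toℚᵘ-fromℚᵘ q) ⟨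
  ℚ.toℚᵘ (ℚ.fromℚᵘ p) ℚᵘ.+ ℚ.toℚᵘ (ℚ.fromℚᵘ q)       ≈⟨ ℚₚ.toℚᵘ-homo-+ (ℚ.fromℚᵘ p) (ℚ.fromℚᵘ q) ⟨
  ℚ.toℚᵘ (ℚ.fromℚᵘ p ℚ.+ ℚ.fromℚᵘ q)                 ∎)
  where open import Relation.Binary.Reasoning.Setoid ℚᵘₚ.≃-setoid

fromℚᵘ-homo-* : ∀ p q → ℚ.fromℚᵘ (p ℚᵘ.* q) ≡ ℚ.fromℚᵘ p ℚ.* ℚ.fromℚᵘ q
fromℚᵘ-homo-* p q = ℚₚ.toℚᵘ-injective (begin
  ℚ.toℚᵘ (ℚ.fromℚᵘ (p ℚᵘ.* q))                       ≈⟨ ℚₚ.toℚᵘ-fromℚᵘ (p ℚᵘ.* q) ⟩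
  p ℚᵘ.* q                                           ≈⟨ ℚᵘₚ.*-cong (ℚₚ.toℚᵘ-fromℚᵘ p) (ℚₚ.toℚᵘ-fromℚᵘ q) ⟨
  ℚ.toℚᵘ (ℚ.fromℚᵘ p) ℚᵘ.* ℚ.toℚᵘ (ℚ.fromℚᵘ q)       ≈⟨ ℚₚ.toℚᵘ-homo-* (ℚ.fromℚᵘ p) (ℚ.fromℚᵘ q) ⟨
  ℚ.toℚᵘ (ℚ.fromℚᵘ p ℚ.* ℚ.fromℚᵘ q)                 ∎)
  where open import Relation.Binary.Reasoning.Setoid ℚᵘₚ.≃-setoid

ℤ→ℚ-homo-+ : ∀ a b → ℤ→ℚ (a ℤ.+ b) ≡ ℤ→ℚ a ℚ.+ ℤ→ℚ b
ℤ→ℚ-homo-+ a b = trans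
  -- Adding `a / 1` and `b / 1` without normalising gives the numerator `a * 1 + b * 1`, which does
  -- not reduce to `a + b` by computation.
  (cong ℤ→ℚ (sym (cong₂ ℤ._+_ (ℤₚ.*-identityʳ a) (ℤₚ.*-identityʳ b))))
  (fromℚᵘ-homo-+ (mkℚᵘ a 0) (mkℚᵘ b 0))

ℤ→ℚ-homo-* : ∀ a b → ℤ→ℚ (a ℤ.* b) ≡ ℤ→ℚ a ℚ.* ℤ→ℚ b
ℤ→ℚ-homo-* a b = fromℚᵘ-homo-* (mkℚᵘ a 0) (mkℚᵘ b 0)

ℕ→ℚ-homo-+ : ∀ j k → ℕ→ℚ (j ℕ.+ k) ≡ ℕ→ℚ j ℚ.+ ℕ→ℚ k
ℕ→ℚ-homo-+ j k = ℤ→ℚ-homo-+ (+ j) (+ k)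

ℕ→ℚ-homo-* : ∀ j k → ℕ→ℚ (j ℕ.* k) ≡ ℕ→ℚ j ℚ.* ℕ→ℚ k
ℕ→ℚ-homo-* j k = trans (cong ℤ→ℚ (ℤₚ.pos-* j k)) (ℤ→ℚ-homo-* (+ j) (+ k))

fromℤ : ℤ → PowerSeries
fromℤ (+ k)      = # k
fromℤ (-[1+ k ]) = λ n → ℚ.- (# (suc k)) n

fromℤ≈constant : ∀ z → fromℤ z ≈ constant (ℤ→ℚ z)
fromℤ≈constant (+ k)      zero    = refl
fromℤ≈constant (+ k)      (suc n) = refl
fromℤ≈constant (-[1+ k ]) zero    = refl
fromℤ≈constant (-[1+ k ]) (suc n) = refl

constant-homo-+ : ∀ p q → constant (p ℚ.+ q) ≈ constant p + constant q
constant-homo-+ p q zero    = refl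
constant-homo-+ p q (suc n) = refl

constant-homo-* : ∀ p q → constant (p ℚ.* q) ≈ constant p * constant q
constant-homo-* p q zero    = sym (constant-* p (constant q) zero)
constant-homo-* p q (suc n) = sym (trans (constant-* p (constant q) (suc n)) (ℚₚ.*-zeroʳ p))

-- A literal `con (+ k)` of the solver below evaluates to `# k`.
fromℤ-homomorphism : ℤ.+-*-rawRing -Raw-AlmostCommutative⟶ fromCommutativeRing powerSeriesRing
fromℤ-homomorphism = record
  { ⟦_⟧    = fromℤ
  ; +-homo = λ a b n → begin
      fromℤ (a ℤ.+ b) n                             ≡⟨ fromℤ≈constant (a ℤ.+ b) n ⟩
      constant (ℤ→ℚ (a ℤ.+ b)) n                    ≡⟨ cong (λ q → constant q n) (ℤ→ℚ-homo-+ a b) ⟩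
      constant (ℤ→ℚ a ℚ.+ ℤ→ℚ b) n                  ≡⟨ constant-homo-+ (ℤ→ℚ a) (ℤ→ℚ b) n ⟩
      (constant (ℤ→ℚ a) + constant (ℤ→ℚ b)) n       ≡⟨ cong₂ ℚ._+_ (fromℤ≈constant a n) (fromℤ≈constant b n) ⟨
      (fromℤ a + fromℤ b) n                         ∎
  ; *-homo = λ a b n → begin
      fromℤ (a ℤ.* b) n                             ≡⟨ fromℤ≈constant (a ℤ.* b) n ⟩
      constant (ℤ→ℚ (a ℤ.* b)) n                    ≡⟨ cong (λ q → constant q n) (ℤ→ℚ-homo-* a b) ⟩
      constant (ℤ→ℚ a ℚ.* ℤ→ℚ b) n                  ≡⟨ constant-homo-* (ℤ→ℚ a) (ℤ→ℚ b) n ⟩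
      (constant (ℤ→ℚ a) * constant (ℤ→ℚ b)) n       ≡⟨ *-cong (fromℤ≈constant a) (fromℤ≈constant b) n ⟨
      (fromℤ a * fromℤ b) n                         ∎
  ; -‿homo = -‿homo
  ; 0-homo = λ { zero → refl ; (suc _) → refl }
  ; 1-homo = λ _ → refl
  }
  where
  open ≡-Reasoning
  -‿homo : ∀ z n → fromℤ (ℤ.- z) n ≡ ℚ.- fromℤ z n
  -‿homo (+ zero)   zero    = refl
  -‿homo (+ zero)   (suc n) = refl
  -‿homo +[1+ k ]   n       = refl
  -‿homo (-[1+ k ]) n       = sym (⁻¹-involutive ((# (suc k)) n))

-- Coefficients are integers because their equality is decidable, unlike that of power series; this
-- lets the normaliser recognise cancellation.
module PowerSeriesSolver where
  open import Algebra.Solver.Ring ℤ.+-*-rawRing (fromCommutativeRing powerSeriesRing)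
    fromℤ-homomorphism (λ a b → map (λ a≡b n → cong (λ z → fromℤ z n) a≡b) (dec⇒maybe (a ℤₚ.≟ b)))
    public

-- The summand with factor 8 contains the difference of the two sides of the functional equation, so
-- it vanishes at `f = S`; the same difference appears in `product-identity`.
square-identity : ∀ f x → let r = # 1 + x - # 4 * f in
  r * r ≈ # 1 - # 6 * x + x * x + # 8 * (x + f * (f + f) - (f + x * f))
square-identity = solve 2 (λ f x → let r = con (+ 1) :+ x :- con (+ 4) :* f in
  r :* r := con (+ 1) :- con (+ 6) :* x :+ x :* x :+ con (+ 8) :* (x :+ f :* (f :+ f) :- (f :+ x :* f)))
  (λ _ → refl)
  where open PowerSeriesSolver

product-identity : ∀ f x → let r = # 1 + x - # 4 * f in
  f * (# 1 + x + r) ≈ # 2 * x - # 2 * (x + f * (f + f) - (f + x * f))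
product-identity = solve 2 (λ f x → let r = con (+ 1) :+ x :- con (+ 4) :* f in
  f :* (con (+ 1) :+ x :+ r) := con (+ 2) :* x :- con (+ 2) :* (x :+ f :* (f :+ f) :- (f :+ x :* f)))
  (λ _ → refl)
  where open PowerSeriesSolver

*≈⇒≈/ : ∀ f g h .{{_ : ℚ.NonZero (g 0)}} → f * g ≈ h → f ≈ h / g
*≈⇒≈/ f g h fg≈h = begin
  f                ≈⟨ *-identityʳ f ⟨
  f * # 1          ≈⟨ *-cong {f} (λ _ → refl) (⁻¹-inverse g) ⟨
  f * (g * g ⁻¹)   ≈⟨ *-assoc f g (g ⁻¹) ⟨
  f * g * g ⁻¹     ≈⟨ *-cong {g = g ⁻¹} fg≈h (λ _ → refl) ⟩
  h * g ⁻¹         ∎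
  where
  open CommutativeRing powerSeriesRing using (setoid; *-identityʳ)
  open import Relation.Binary.Reasoning.Setoid setoid

-- Generating functions of weighted types

-- The size is recorded as a rational so that a coefficient of a `PowerSeries` can serve directly.
HasCardinality : Set → ℚ → Set
HasCardinality A q = ∃ λ k → (A ↔ Fin k) × q ≡ ℕ→ℚ k

Fibre : {A : Set} → (A → ℕ) → ℕ → Set
Fibre w n = ∃ λ a → w a ≡ n

HasGF : {A : Set} → (A → ℕ) → PowerSeries → Set
HasGF w f = ∀ n → HasCardinality (Fibre w n) (f n)

private
  variable
    A B : Set
    p q : ℚ

cardinality-↔ : A ↔ B → HasCardinality B q → HasCardinality A q
cardinality-↔ A↔B (k , B↔ , q≡) = k , ↔-trans A↔B B↔ , q≡

-- Composing the two bijections gives `Fin j ↔ Fin k`, hence `j ≡ k`. This is the point where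
-- bijections become equations between coefficients.
cardinality-unique : HasCardinality A p → HasCardinality A q → p ≡ q
cardinality-unique (_ , A↔j , p≡) (_ , A↔k , q≡) =
  trans p≡ (trans (cong ℕ→ℚ (↔⇒≡ (↔-trans (↔-sym A↔j) A↔k))) (sym q≡))

cardinality-empty : (A → ⊥) → HasCardinality A 0ℚ
cardinality-empty ¬a =
  0 , ↔-trans (mk↔ₛ′ ¬a ⊥-elim (λ ()) (⊥-elim ∘ ¬a)) (↔-sym 0↔⊥) , refl

cardinality-⊎ : HasCardinality A p → HasCardinality B q → HasCardinality (A ⊎ B) (p ℚ.+ q)
cardinality-⊎ (j , A↔ , p≡) (k , B↔ , q≡) =
  j ℕ.+ k , ↔-trans (A↔ ⊎-↔ B↔) (↔-sym +↔⊎) ,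
  trans (cong₂ ℚ._+_ p≡ q≡) (sym (ℕ→ℚ-homo-+ j k))

cardinality-× : HasCardinality A p → HasCardinality B q → HasCardinality (A × B) (p ℚ.* q)
cardinality-× (j , A↔ , p≡) (k , B↔ , q≡) =
  j ℕ.* k , ↔-trans (A↔ ×-↔ B↔) (↔-sym *↔×) ,
  trans (cong₂ ℚ._*_ p≡ q≡) (sym (ℕ→ℚ-homo-* j k))

cardinality-Σ : ∀ n {F : Fin n → Set} {q : Fin n → ℚ} → (∀ i → HasCardinality (F i) (q i)) →
                HasCardinality (∃ F) (∑[ i < n ] q i)
cardinality-Σ zero    card = cardinality-empty λ ()
cardinality-Σ (suc n) card = cardinality-↔
  (mk↔ₛ′ (λ { (zero , x) → inj₁ x ; (suc i , x) → inj₂ (i , x) })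
         [ (λ x → zero , x) , (λ (i , x) → suc i , x) ]
         (λ { (inj₁ _) → refl ; (inj₂ _) → refl })
         (λ { (zero , _) → refl ; (suc _ , _) → refl }))
  (cardinality-⊎ (card zero) (cardinality-Σ n (card ∘ suc)))

fibre-≡ : ∀ {w : A → ℕ} {n} {x y : Fibre w n} → proj₁ x ≡ proj₁ y → x ≡ y
fibre-≡ refl = cong (_ ,_) (ℕₚ.≡-irrelevant _ _)

HasGF-⊎ : ∀ {v : A → ℕ} {w : B → ℕ} {f g} → HasGF v f → HasGF w g → HasGF [ v , w ]′ (f + g)
HasGF-⊎ V W n = cardinality-↔
  (mk↔ₛ′ (λ { (inj₁ a , e) → inj₁ (a , e) ; (inj₂ b , e) → inj₂ (b , e) })
         [ (λ (a , e) → inj₁ a , e) , (λ (b , e) → inj₂ b , e) ]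
         (λ { (inj₁ _) → refl ; (inj₂ _) → refl })
         (λ { (inj₁ _ , _) → refl ; (inj₂ _ , _) → refl }))
  (cardinality-⊎ (V n) (W n))

infixr 7 _⊕_
_⊕_ : (A → ℕ) → (B → ℕ) → A × B → ℕ
(v ⊕ w) (a , b) = v a ℕ.+ w b

-- Pairs of total weight `n` are sorted by the weight `i` of the first component, which is the
-- summation index of the Cauchy product.
fibre-⊕ : ∀ (v : A → ℕ) (w : B → ℕ) n →
          Fibre (v ⊕ w) n ↔ ∃ λ (i : Fin (suc n)) → Fibre v (toℕ i) × Fibre w (n ∸ toℕ i)
fibre-⊕ {A} {B} v w n = mk↔ₛ′ to from to∘from λ _ → fibre-≡ refl
  where
  Split : Set
  Split = ∃ λ (i : Fin (suc n)) → Fibre v (toℕ i) × Fibre w (n ∸ toℕ i)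

  va<1+n : ∀ {a b} → v a ℕ.+ w b ≡ n → v a ℕ.< suc n
  va<1+n {a} e = s≤s (ℕₚ.m+n≤o⇒m≤o (v a) (ℕₚ.≤-reflexive e))

  to : Fibre (v ⊕ w) n → Split
  to ((a , b) , e) = fromℕ< (va<1+n e) , (a , sym va≡) , (b , wb≡)
    where
    va≡ : toℕ (fromℕ< (va<1+n e)) ≡ v a
    va≡ = toℕ-fromℕ< (va<1+n e)
    wb≡ : w b ≡ n ∸ toℕ (fromℕ< (va<1+n e))
    wb≡ = trans (sym (ℕₚ.m+n∸m≡n (v a) (w b))) (cong₂ _∸_ e (sym va≡))

  from : Split → Fibre (v ⊕ w) n
  from (i , (a , p) , (b , q)) =
    (a , b) , trans (cong₂ ℕ._+_ p q) (ℕₚ.m+[n∸m]≡n (toℕ≤pred[n] i))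

  -- The two indices are separate variables so that `i ≡ j` can be matched with `refl`; the weight
  -- proofs depending on them then agree by irrelevance.
  split-≡ : ∀ {i j a b} {p : v a ≡ toℕ i} {p′ : v a ≡ toℕ j}
            {q : w b ≡ n ∸ toℕ i} {q′ : w b ≡ n ∸ toℕ j} → i ≡ j →
            _≡_ {A = Split} (i , (a , p) , (b , q)) (j , (a , p′) , (b , q′))
  split-≡ {i = i} refl = cong (i ,_) (cong₂ _,_ (fibre-≡ refl) (fibre-≡ refl))

  to∘from : ∀ x → to (from x) ≡ x
  to∘from (i , (a , p) , _) = split-≡ (toℕ-injective (trans (toℕ-fromℕ< _) p))

HasGF-× : ∀ {v : A → ℕ} {w : B → ℕ} {f g} → HasGF v f → HasGF w g → HasGF (v ⊕ w) (f * g)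
HasGF-× {v = v} {w = w} V W n = cardinality-↔ (fibre-⊕ v w n)
  (cardinality-Σ (suc n) λ i → cardinality-× (V (toℕ i)) (W (n ∸ toℕ i)))

-- A bijection that preserves weight restricts to a bijection between the fibres over each `n`.
HasGF-unique : ∀ {v : A → ℕ} {w : B → ℕ} {f g} (A↔B : A ↔ B) →
               (∀ a → w (Inverse.to A↔B a) ≡ v a) → HasGF v f → HasGF w g → f ≈ g
HasGF-unique {v = v} {w = w} A↔B w≡v V W n =
  cardinality-unique (V n) (cardinality-↔ fibres (W n))
  where
  open Inverse A↔B
  fibres : Fibre v n ↔ Fibre w n
  fibres = mk↔ₛ′
    (λ (a , e) → to a , trans (w≡v a) e)
    (λ (b , e) → from b , trans (sym (w≡v (from b))) (trans (cong w (strictlyInverseˡ b)) e))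
    (λ (b , _) → fibre-≡ (strictlyInverseˡ b))
    (λ (a , _) → fibre-≡ (strictlyInverseʳ a))

HasGF-X : HasGF {⊤} (const 1) X
HasGF-X zero          = cardinality-empty λ ()
HasGF-X (suc zero)    =
  1 , ↔-trans (mk↔ₛ′ (λ _ → tt) (λ _ → tt , refl) (λ _ → refl) (λ _ → fibre-≡ refl)) (↔-sym 1↔⊤) , refl
HasGF-X (suc (suc n)) = cardinality-empty λ ()

-- Schroeder trees

Tree : Set
Tree = ∃ IsSchroeder

leafCount : Tree → ℕ
leafCount (t , _) = leaves t

HasGF-S : HasGF leafCount S
HasGF-S n = cardinality-↔
  (mk↔ₛ′ (λ ((t , p) , e) → t , p , e) (λ (t , p , e) → (t , p) , e) (λ _ → refl) (λ _ → refl))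
  (counted n)
  where
  counted : ∀ n → HasCardinality (SchroederTree n) (S n)
  -- `S 0` is `0ℚ` by definition rather than through `s`, so it has to be checked that every tree
  -- has a leaf.
  counted zero    = cardinality-empty λ (t , _ , e) → ℕₚ.<⇒≢ (leaves>0 t) (sym e)
  counted (suc n) = s (suc n) , s-counts (suc n) , refl

-- A non-leaf tree is its first child t together with the list us of its other
-- children. If us = [u] it corresponds to (t , inj₁ u), and otherwise to
-- (t , inj₂ (node us)). The pairs (t , inj₂ leaf) that are missed make up the
-- summand ⊤ × Tree.
decompose : (⊤ ⊎ Tree × (Tree ⊎ Tree)) ↔ (Tree ⊎ ⊤ × Tree)
decompose = mk↔ₛ′ to from to∘from from∘to
  where
  to : ⊤ ⊎ Tree × (Tree ⊎ Tree) → Tree ⊎ ⊤ × Tree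
  to (inj₁ tt)                                             = inj₁ (node [] , leaf)
  to (inj₂ ((t , p) , inj₁ (u , q))) =
    inj₁ (node (t ∷ u ∷ []) , branch (s≤s (s≤s z≤n)) (p ∷ q ∷ []))
  to (inj₂ (tp , inj₂ (_ , leaf)))                         = inj₂ (tt , tp)
  to (inj₂ ((t , p) , inj₂ (node us , branch l qs))) =
    inj₁ (node (t ∷ us) , branch (ℕₚ.m≤n⇒m≤1+n l) (p ∷ qs))

  from : Tree ⊎ ⊤ × Tree → ⊤ ⊎ Tree × (Tree ⊎ Tree)
  from (inj₁ (_ , leaf))                                   = inj₁ tt
  from (inj₁ (_ , branch (s≤s ()) (_ ∷ [])))
  from (inj₁ (_ , branch (s≤s _) (p ∷ q ∷ [])))            = inj₂ ((_ , p) , inj₁ (_ , q))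
  from (inj₁ (_ , branch (s≤s _) (p ∷ qs@(_ ∷ _ ∷ _)))) =
    inj₂ ((_ , p) , inj₂ (_ , branch (s≤s (s≤s z≤n)) qs))
  from (inj₂ (tt , tp))                                    = inj₂ (tp , inj₂ (_ , leaf))

  to∘from : ∀ x → to (from x) ≡ x
  to∘from (inj₁ (_ , leaf))                                = refl
  to∘from (inj₁ (_ , branch (s≤s ()) (_ ∷ [])))
  -- Here and in the next case the tree is rebuilt unchanged; only the proof that it has at least
  -- two children may differ.
  to∘from (inj₁ (_ , branch (s≤s _) (_ ∷ _ ∷ []))) =
    cong (λ p → inj₁ (_ , p)) (isSchroeder-irrelevant _ _)
  to∘from (inj₁ (_ , branch (s≤s _) (_ ∷ _ ∷ _ ∷ _))) =
    cong (λ p → inj₁ (_ , p)) (isSchroeder-irrelevant _ _)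
  to∘from (inj₂ _)                                         = refl

  from∘to : ∀ x → from (to x) ≡ x
  from∘to (inj₁ tt)                                        = refl
  from∘to (inj₂ (_ , inj₁ _))                              = refl
  from∘to (inj₂ (_ , inj₂ (_ , leaf)))                     = refl
  from∘to (inj₂ (_ , inj₂ (_ , branch (s≤s ()) (_ ∷ []))))
  from∘to (inj₂ (tp , inj₂ (_ , branch (s≤s _) (_ ∷ _ ∷ _)))) =
    cong (λ p → inj₂ (tp , inj₂ (_ , p))) (isSchroeder-irrelevant _ _)

decompose-leaves : ∀ x → [ leafCount , const 1 ⊕ leafCount ]′ (Inverse.to decompose x)
                       ≡ [ const 1 , leafCount ⊕ [ leafCount , leafCount ]′ ]′ x
decompose-leaves (inj₁ tt)                                  = refl
decompose-leaves (inj₂ ((t , _) , inj₁ (u , _))) =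
    cong (leaves t ℕ.+_) (ℕₚ.+-identityʳ (leaves u))
-- The weight 1 of `tt` stands for the single leaf of the second component.
decompose-leaves (inj₂ ((t , _) , inj₂ (_ , leaf)))         = ℕₚ.+-comm 1 (leaves t)
-- For nonempty `us`, `leaves (node us)` computes to `leaves* us`; a childless node counts 1
-- instead, hence the pattern.
decompose-leaves (inj₂ (_ , inj₂ (_ , branch _ (_ ∷ _))))   = refl

-- The functional equation and its solution

S-equation : X + S * (S + S) ≈ S + X * S
-- Each side of `decompose` is read off termwise: `⊎` becomes `+`, `×` becomes `*`, and `⊤` with
-- weight 1 becomes `X`.
S-equation = HasGF-unique decompose decompose-leaves
  (HasGF-⊎ HasGF-X (HasGF-× HasGF-S (HasGF-⊎ HasGF-S HasGF-S)))
  (HasGF-⊎ HasGF-S (HasGF-× HasGF-X HasGF-S))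

S-defect≈0 : X + S * (S + S) - (S + X * S) ≈ const 0ℚ
S-defect≈0 n = trans (cong (ℚ._- (S + X * S) n) (S-equation n)) (ℚₚ.+-inverseʳ ((S + X * S) n))

*-zeroʳ-≈ : ∀ f {g} → g ≈ const 0ℚ → f * g ≈ const 0ℚ
*-zeroʳ-≈ f {g} g≈0 n = trans (*-comm f g n) (trans (*-cong {g = f} g≈0 (λ _ → refl) n) (*-zeroˡ f n))

R : PowerSeries
R = # 1 + X - # 4 * S

R≈√ : R ≈ √ (# 1 - # 6 * X + X * X)
-- The `refl` computes `R 0` to `1ℚ`, using that `S 0` is `0ℚ`; this selects `R` rather than its
-- negative as the root.
R≈√ = √-unique _ R refl λ n → trans (square-identity S X n)
  (trans (cong ((# 1 - # 6 * X + X * X) n ℚ.+_) (*-zeroʳ-≈ (# 8) S-defect≈0 n)) (ℚₚ.+-identityʳ _))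

theorem1p1 : S ≈ (# 2 * X) / (# 1 + X + √ (# 1 - # 6 * X + X * X))
theorem1p1 = *≈⇒≈/ S (# 1 + X + √ (# 1 - # 6 * X + X * X)) (# 2 * X) λ n → trans
  -- Replacing the root by `R` makes the denominator a polynomial in `X` and `S`, to which
  -- `product-identity` applies.
  (*-cong {f = S} (λ _ → refl) (λ m → cong ((# 1 + X) m ℚ.+_) (sym (R≈√ m))) n)
  (trans (product-identity S X n)
    (trans (cong (λ x → (# 2 * X) n ℚ.- x) (*-zeroʳ-≈ (# 2) S-defect≈0 n)) (ℚₚ.+-identityʳ _)))
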